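{- Let $Y$ be a discrete topological space. The following conditions are equivalent: (a) $|Y|\leq\mathfrak c$; (b) $\omega^{*}\rightarrow(Y)^{1}_{\mathfrak c}$; (c) $\omega^{*}\rightarrow(Y)^{1}_{2}$; (d) $Y$ is homeomorphic to a subspace of $\omega^{*}$.
   Context: $\mathfrak c=2^{\aleph_0}$. $\omega$ is the countably infinite discrete space, $\beta(\omega)$ its Stone-Čech compactification, and $\omega^{*}=\beta(\omega)\setminus\omega$ with the subspace topology. For topological spaces $X,Y$ and a cardinal $\lambda$, the relation $X\rightarrow(Y)^{1}_{\lambda}$ means: whenever $X=\bigcup_{i<\lambda}P_i$, there are $i<\lambda$ and $Y'\subseteq P_i$ such that $Y'$ (with the subspace topology from $X$) is homeomorphic to $Y$. -}

module Defs where

open import Level using (0ℓ; Lift) renaming (suc to lsuc)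
open import Data.Bool.Base using (Bool)
open import Data.List.Base using (List)
open import Data.List.Relation.Unary.Any using (Any)
open import Data.Nat.Base using (ℕ)
open import Data.Product.Base using (Σ-syntax; ∃; _×_; _,_; proj₁; proj₂)
open import Data.Refinement.Base using (Refinement; value)
open import Data.Unit.Base using (⊤; tt)
open import Function.Base using (_∘_)
open import Function.Bundles using (_↔_; _↣_; module Inverse)
open import Function.Definitions using (Injective)
open import Relation.Binary.PropositionalEquality.Core
  using (_≡_; _≢_; _≗_)
open import Relation.Unary
  using (Pred; _∈_; _⊆_; _≐_; _∩_; _≬_; _⊥_; ⋃; ∁; U; Universal; Satisfiable)

-- Everything lives over Set, which plays the role of the universe of sets.
-- Under excluded middle every subset of A is of the form {x | f x ≡ true} for
-- some f : A → Bool, so every family of subsets of A can be indexed by some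
-- I : Set; closure of the opens under Set-indexed unions is then closure
-- under arbitrary unions, and likewise for covers in the definition of
-- compactness.

Subset : Set → Set₁
Subset A = Pred A 0ℓ

-- Subsets are predicates and are equal when they have the same elements (_≐_);
-- Open-resp says that openness depends only on the elements.

record Space : Set₂ where
  field
    Carrier   : Set
    Open      : Pred (Subset Carrier) (lsuc 0ℓ)
    Open-resp : ∀ {V W} → V ≐ W → Open V → Open W
    Open-U    : Open U
    Open-∩    : ∀ {V W} → Open V → Open W → Open (V ∩ W)
    Open-⋃    : ∀ {I : Set} (V : I → Subset Carrier) →
                (∀ i → Open (V i)) → Open (⋃ I V)

open Space public

Discrete : Space → Set₁
Discrete X = ∀ (V : Subset (Carrier X)) → Open X V

-- Points of a subspace carry their membership proof irrelevantly, so two of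
-- them are equal exactly when they are equal in X.

Subspace : (X : Space) → Subset (Carrier X) → Space
Subspace X S = record
  { Carrier   = Refinement (Carrier X) S
  ; Open      = λ V → Σ[ W ∈ Subset (Carrier X) ] Open X W × V ≐ (W ∘ value)
  ; Open-resp = λ { (V⊆V′ , V′⊆V) (W , oW , V⊆W , W⊆V) →
                    W , oW , (λ p → V⊆W (V′⊆V p)) , (λ p → V⊆V′ (W⊆V p)) }
  ; Open-U    = U , Open-U X , (λ _ → tt) , (λ _ → tt)
  ; Open-∩    = λ { (W , oW , V⊆W , W⊆V) (W′ , oW′ , V′⊆W′ , W′⊆V′) →
                    (W ∩ W′) , Open-∩ X oW oW′ ,
                    (λ { (p , q) → V⊆W p , V′⊆W′ q }) ,
                    (λ { (p , q) → W⊆V p , W′⊆V′ q }) }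
  ; Open-⋃    = λ {I} V o →
                    ⋃ I (λ i → proj₁ (o i)) ,
                    Open-⋃ X (λ i → proj₁ (o i)) (λ i → proj₁ (proj₂ (o i))) ,
                    (λ { (i , p) → i , proj₁ (proj₂ (proj₂ (o i))) p }) ,
                    (λ { (i , p) → i , proj₂ (proj₂ (proj₂ (o i))) p })
  }

Continuous : (X Y : Space) → (Carrier X → Carrier Y) → Set₁
Continuous X Y f = ∀ (V : Subset (Carrier Y)) → Open Y V → Open X (V ∘ f)

infix 4 _≅_

record _≅_ (X Y : Space) : Set₁ where
  field
    bijection       : Carrier X ↔ Carrier Y
    to-continuous   : Continuous X Y (Inverse.to bijection)
    from-continuous : Continuous Y X (Inverse.from bijection)

-- Homeomorphism onto the image, the image having the subspace topology.

record Embedding (X Y : Space) (f : Carrier X → Carrier Y) : Set₁ where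
  field
    injective  : Injective _≡_ _≡_ f
    continuous : Continuous X Y f
    initial    : ∀ (V : Subset (Carrier X)) → Open X V →
                 Σ[ W ∈ Subset (Carrier Y) ] Open Y W × V ≐ (W ∘ f)

Image : {A B : Set} → (A → B) → Subset B
Image f y = ∃ λ x → f x ≡ y

Dense : (X : Space) → Subset (Carrier X) → Set₁
Dense X S = ∀ (V : Subset (Carrier X)) → Open X V → Satisfiable V → V ≬ S

Hausdorff : Space → Set₁
Hausdorff X = ∀ {x y : Carrier X} → x ≢ y →
  Σ[ V ∈ Subset (Carrier X) ] Σ[ W ∈ Subset (Carrier X) ]
    Open X V × Open X W × x ∈ V × y ∈ W × V ⊥ W

Compact : Space → Set₁
Compact X = ∀ {I : Set} (V : I → Subset (Carrier X)) →
  (∀ i → Open X (V i)) → Universal (⋃ I V) →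
  Σ[ is ∈ List I ] (∀ x → Any (λ i → x ∈ V i) is)

-- (K , ι) is the Stone–Čech compactification of X, which is determined up to
-- a unique homeomorphism over X. Extensions are unique because ι has dense
-- image and Z is Hausdorff.

record IsStoneČech (X K : Space) (ι : Carrier X → Carrier K) : Set₂ where
  field
    compact   : Compact K
    hausdorff : Hausdorff K
    embedding : Embedding X K ι
    dense     : Dense K (Image ι)
    extend    : ∀ (Z : Space) → Compact Z → Hausdorff Z →
                ∀ (f : Carrier X → Carrier Z) → Continuous X Z f →
                Σ[ g ∈ (Carrier K → Carrier Z) ] Continuous K Z g × g ∘ ι ≗ f

ω : Space
ω = record
  { Carrier   = ℕ
  ; Open      = λ _ → Lift (lsuc 0ℓ) ⊤
  ; Open-resp = λ _ _ → _
  ; Open-U    = _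
  ; Open-∩    = λ _ _ → _
  ; Open-⋃    = λ _ _ → _
  }

Remainder : (X K : Space) → (Carrier X → Carrier K) → Space
Remainder X K ι = Subspace K (∁ (Image ι))

-- A cardinal is represented by a set of that cardinality.

𝔠 : Set
𝔠 = ℕ → Bool

infix 4 _≤ᶜ_

_≤ᶜ_ : Set → Set → Set
A ≤ᶜ B = A ↣ B

infix 4 _⟶⟨_⟩¹_

-- X ⟶⟨ Λ ⟩¹ Y is the relation X → (Y)¹_Λ. The pieces need not be disjoint.

_⟶⟨_⟩¹_ : Space → Set → Space → Set₁
X ⟶⟨ Λ ⟩¹ Y = ∀ (P : Λ → Subset (Carrier X)) → Universal (⋃ Λ P) →
  Σ[ i ∈ Λ ] Σ[ Y′ ∈ Subset (Carrier X) ] Y′ ⊆ P i × Subspace X Y′ ≅ Y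

{-# OPTIONS --safe #-}

-- Kunen's independent matrix: there are subsets A(X,Z) of ω, for X and Z in
-- 2^ω, such that, along a filter of sets {m | N ≤ size m}, the sets A(X,Z) with
-- X fixed are pairwise disjoint, while finitely many A(Xⱼ,Zⱼ) with distinct Xⱼ
-- always meet. Identify Y with a subset of 2^ω and let the pieces Pᵢ cover ω*,
-- i ∈ 2^ω. If some Pᵢ meets the closure of every A(i,Z), Z ∈ Y, one point from
-- each gives a copy of Y in Pᵢ. Otherwise Pᵢ misses the closure of some A(i,αᵢ)
-- for every i, and by compactness some point of ω* lies in all of these
-- closures, hence in no Pᵢ.
-- Conversely, if Y embeds in ω* as a discrete subspace, regularity of βω gives
-- neighbourhoods of its points with distinct traces on the dense set ω.

module Submission where

open import Defs
open import Axiom.ExcludedMiddle using (ExcludedMiddle)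
open import Axiom.Extensionality.Propositional using (Extensionality)
open import Data.Bool.Base using (Bool; true; false; if_then_else_)
open import Data.Fin.Base using (Fin; zero; suc)
open import Data.Irrelevant using ([_])
open import Data.List.Base
  using (List; []; _∷_; map; length; applyUpTo; cartesianProduct; _++_)
open import Data.List.Extrema.Nat using (max; xs≤max)
open import Data.List.Membership.Propositional using (find) renaming (_∈_ to _∈ˡ_)
open import Data.List.Membership.Propositional.Properties
  using (∈-map⁺; ∈-map⁻; ∈-cartesianProduct⁺; ∈-++⁺ˡ; ∈-++⁺ʳ)
open import Data.List.Properties using (length-applyUpTo; ∷-injectiveˡ; ∷-injectiveʳ)
open import Data.List.Relation.Unary.All as All using (All; []; _∷_)
open import Data.List.Relation.Unary.Any using (Any; here; there)
open import Data.Nat.Base using (ℕ; zero; suc; _≤_; _<_; s≤s)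
open import Data.Nat.Binary.Base using (ℕᵇ; 2[1+_]; 1+[2_]; toℕ; fromℕ)
  renaming (zero to 0ᵇ)
open import Data.Nat.Binary.Properties using (fromℕ-toℕ)
open import Data.Nat.Properties using (1+n≰n)
open import Data.Product.Base
  using (Σ-syntax; ∃; ∃-syntax; _×_; _,_; _,′_; proj₁; proj₂; -,_)
open import Data.Refinement.Base using (value; _,_)
open import Data.Sum.Base using (_⊎_; inj₁; inj₂)
open import Data.Unit.Base using (⊤; tt)
open import Function.Base using (_∘_; id)
open import Function.Bundles
  using (_⇔_; mk⇔; mk↣; mk↔ₛ′; module Injection; module Inverse)
open import Function.Properties.Inverse using (↔-sym)
open import Level using (0ℓ; Lift) renaming (suc to lsuc)
open import Relation.Binary.PropositionalEquality
  using (_≡_; _≢_; _≗_; refl; sym; trans; cong; subst)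
open import Relation.Nullary
  using (¬_; does; yes; no; contradiction; recompute)
open import Relation.Nullary.Decidable using (dec-true; decidable-stable)
open import Relation.Unary
  using (_∈_; _∉_; _⊆_; _⊥_; ⋃; U)

-- Preliminaries on topological spaces.

discrete : Set → Space
discrete A = record
  { Carrier   = A
  ; Open      = λ _ → Lift (lsuc 0ℓ) ⊤
  ; Open-resp = λ _ _ → _
  ; Open-U    = _
  ; Open-∩    = λ _ _ → _
  ; Open-⋃    = λ _ _ → _
  }

discrete-hausdorff : ∀ {A} → Hausdorff (discrete A)
discrete-hausdorff {x = x} {y} x≢y =
  (_≡ x) , (_≡ y) , _ , _ , refl , refl , λ { (refl , refl) → x≢y refl }

discrete-Bool-compact : Compact (discrete Bool)
discrete-Bool-compact V _ cover =
  proj₁ (cover false) ∷ proj₁ (cover true) ∷ [] ,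
  λ { false → here (proj₂ (cover false))
    ; true  → there (here (proj₂ (cover true))) }

Open-All : ∀ (X : Space) {I : Set} (V : I → Subset (Carrier X)) →
           (∀ i → Open X (V i)) → ∀ is → Open X (λ x → All (λ i → x ∈ V i) is)
Open-All X V oV []       = Open-resp X ((λ _ → []) , λ _ → tt) (Open-U X)
Open-All X V oV (i ∷ is) =
  Open-resp X ((λ (p , ps) → p ∷ ps) , λ { (p ∷ ps) → p , ps })
    (Open-∩ X (oV i) (Open-All X V oV is))

-- Regularity at `x`: `separate` says that the closure of `V` lies in `W`, without mentioning
-- closures.
record Shrinking (X : Space) (x : Carrier X) (W : Subset (Carrier X)) : Set₁ where
  field
    V        : Subset (Carrier X)
    V-open   : Open X V
    x∈V      : x ∈ V
    separate : ∀ {z} → z ∉ W → Σ[ O ∈ Subset (Carrier X) ] Open X O × z ∈ O × (O ⊥ V)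

≅-sym : ∀ {X Y} → X ≅ Y → Y ≅ X
≅-sym h = record
  { bijection       = ↔-sym (_≅_.bijection h)
  ; to-continuous   = _≅_.from-continuous h
  ; from-continuous = _≅_.to-continuous h
  }

-- Coding finite lists of words by natural numbers.

decodeBits : List Bool → List (List (Bool × Bool))
-- `true` closes a word; `false` announces one letter, given by the next two bits. Malformed strings
-- get a junk value, which does not affect surjectivity.
decodeBits (true ∷ bs)          = [] ∷ decodeBits bs
decodeBits (false ∷ a ∷ b ∷ bs) with decodeBits bs
... | []     = []
... | w ∷ ws = ((a , b) ∷ w) ∷ ws
decodeBits _                    = []

decodeBits-surjective : ∀ ws → ∃[ bs ] decodeBits bs ≡ ws
decodeBits-surjective []       = [] , refl
decodeBits-surjective (w ∷ ws) = push w
  where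
  push : ∀ w → ∃[ bs ] decodeBits bs ≡ w ∷ ws
  push [] with bs , eq ← decodeBits-surjective ws = true ∷ bs , cong ([] ∷_) eq
  push ((a , b) ∷ w) with bs , eq ← push w = false ∷ a ∷ b ∷ bs , lemma
    where
    lemma : decodeBits (false ∷ a ∷ b ∷ bs) ≡ ((a , b) ∷ w) ∷ ws
    lemma rewrite eq = refl

-- The numerals in `ℕᵇ` are zeroless binary, hence correspond exactly to finite bit strings.
bits : ℕᵇ → List Bool
bits 0ᵇ       = []
bits 2[1+ n ] = true ∷ bits n
bits 1+[2 n ] = false ∷ bits n

bits-surjective : ∀ bs → ∃[ n ] bits n ≡ bs
bits-surjective []           = 0ᵇ , refl
bits-surjective (true ∷ bs)  with n , eq ← bits-surjective bs = 2[1+ n ] , cong (true ∷_) eq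
bits-surjective (false ∷ bs) with n , eq ← bits-surjective bs = 1+[2 n ] , cong (false ∷_) eq

opaque
  decode : ℕ → List (List (Bool × Bool))
  decode = decodeBits ∘ bits ∘ fromℕ

  decode-surjective : ∀ ws → ∃[ m ] decode m ≡ ws
  decode-surjective ws
    with bs , refl ← decodeBits-surjective ws
    with n , refl ← bits-surjective bs
    = toℕ n , cong (decodeBits ∘ bits) (fromℕ-toℕ n)

-- The matrix on ω and disjointness within a row.

headLength : {A : Set} → List (List A) → ℕ
headLength []      = 0
headLength (w ∷ _) = length w

size : ℕ → ℕ
size = headLength ∘ decode

applyUpTo-injective : ∀ {A : Set} (f g : ℕ → A) n → applyUpTo f n ≡ applyUpTo g n →
                      ∀ k → k < n → f k ≡ g k
applyUpTo-injective f g (suc n) eq zero    _         = ∷-injectiveˡ eq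
applyUpTo-injective f g (suc n) eq (suc k) (s≤s k<n) =
  applyUpTo-injective (f ∘ suc) (g ∘ suc) n (∷-injectiveʳ eq) k k<n

-- m codes a finite set of words; those of length n = size m are read as a
-- relation between binary words of length n. m belongs to the matrix
-- entry (X , Z) when this relation sends X ↾ n to Z ↾ n and to nothing else.

matrix : 𝔠 → 𝔠 → ℕ → Subset ℕ
matrix X Z N m =
  N ≤ size m ×
  applyUpTo (λ k → X k ,′ Z k) (size m) ∈ˡ decode m ×
  (∀ f → applyUpTo f (size m) ∈ˡ decode m →
    (∀ k → k < size m → proj₁ (f k) ≡ X k) →
    ∀ k → k < size m → proj₂ (f k) ≡ Z k)

-- A common element would relate `X ↾ n` to `Z ↾ n`, while the second entry allows only `Z′ ↾ n`.
-- The bound `suc k` puts the coordinate `k` below `n`.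
matrix-disjoint : ∀ X {Z Z′ k} → Z k ≢ Z′ k →
                  matrix X Z 0 ⊥ matrix X Z′ (suc k)
matrix-disjoint X {k = k} Zk≢ ((_ , w∈ , _) , (k<n , _ , unique)) =
  Zk≢ (unique _ w∈ (λ _ _ → refl) k k<n)

-- With `n` and `ws` as variables, membership can be checked on the coded list itself instead of on
-- `decode m`.
matrix-intro : ∀ {X Z N m n ws} → decode m ≡ ws → headLength ws ≡ n → N ≤ n →
  applyUpTo (λ k → X k ,′ Z k) n ∈ˡ ws →
  (∀ f → applyUpTo f n ∈ˡ ws → (∀ k → k < n → proj₁ (f k) ≡ X k) →
    ∀ k → k < n → proj₂ (f k) ≡ Z k) →
  m ∈ matrix X Z N
matrix-intro refl refl N≤n w∈ unique = N≤n , w∈ , unique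

module _ (em : ∀ {ℓ} → ExcludedMiddle ℓ) (fe : ∀ {a b} → Extensionality a b) where

  -- Classical reasoning about subsets and binary sequences.

  by-contradiction : ∀ {ℓ} {P : Set ℓ} → ¬ ¬ P → P
  by-contradiction = decidable-stable em

  indicator : {A : Set} → Subset A → A → Bool
  indicator S x = does (em {P = x ∈ S})

  indicator⁺ : ∀ {A : Set} (S : Subset A) {x} → x ∈ S → indicator S x ≡ true
  indicator⁺ S = dec-true em

  indicator⁻ : ∀ {A : Set} (S : Subset A) {x} → indicator S x ≡ true → x ∈ S
  indicator⁻ S {x} eq with yes p ← em {P = x ∈ S} = p

  ≢⇒differ : ∀ {X Z : 𝔠} → X ≢ Z → ∃[ k ] X k ≢ Z k
  ≢⇒differ X≢Z = by-contradiction λ none →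
    X≢Z (fe λ k → by-contradiction λ Xk≢Zk → none (k , Xk≢Zk))

  -- Independence of the matrix.

  splitting : ∀ (X Z : 𝔠) → ∃[ d ] (∀ n → d ≤ n → (∀ k → k < n → X k ≡ Z k) → X ≡ Z)
  splitting X Z with em {P = X ≡ Z}
  ... | yes X≡Z = 0 , λ _ _ _ → X≡Z
  ... | no  X≢Z with k , Xk≢Zk ← ≢⇒differ X≢Z =
    -- One past a coordinate of difference, so that agreement below `n` includes it.
    suc k , λ n k<n agree → contradiction (agree k k<n) Xk≢Zk

  separating-length : ∀ (Xs : List 𝔠) (Ns : List ℕ) →
    ∃[ n ] (∀ {N} → N ∈ˡ Ns → N ≤ n) ×
           (∀ {X Z} → X ∈ˡ Xs → Z ∈ˡ Xs → (∀ k → k < n → X k ≡ Z k) → X ≡ Z)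
  separating-length Xs Ns =
      max 0 bounds
    , (λ N∈ → ∈⇒≤max (∈-++⁺ʳ _ N∈))
    , λ X∈ Z∈ → proj₂ (splitting _ _) _
        (∈⇒≤max (∈-++⁺ˡ (∈-map⁺ _ (∈-cartesianProduct⁺ X∈ Z∈))))
    where
    bounds : List ℕ
    bounds = map (λ (X , Z) → proj₁ (splitting X Z)) (cartesianProduct Xs Xs) ++ Ns

    ∈⇒≤max : ∀ {b} → b ∈ˡ bounds → b ≤ max 0 bounds
    ∈⇒≤max = All.lookup (xs≤max 0 bounds)

  -- Choose `n` so large that the finitely many rows `X` have distinct restrictions to `n`, and let
  -- `m` code the finite relation sending each `X ↾ n` to `α X ↾ n`. Distinctness makes this
  -- relation single-valued.
  matrix-independent : ∀ (α : 𝔠 → 𝔠) (is : List (𝔠 × ℕ)) →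
    ∃[ m ] (∀ {i} → i ∈ˡ is → let (X , N) = i in m ∈ matrix X (α X) N)
  matrix-independent α is =
    let
      n , ∈⇒≤n , separated = separating-length Xs (map proj₂ is)
      m , decode-m = decode-surjective (map (word n) Xs)
    in m , λ {(X , N)} i∈ →
      let X∈ = there (∈-map⁺ proj₁ i∈)
      in matrix-intro decode-m (length-applyUpTo _ n) (∈⇒≤n (∈-map⁺ proj₂ i∈))
           (∈-map⁺ (word n) X∈) (unique separated X∈)
    where
    -- The extra element makes the coded list nonempty, so that its size is n.
    Xs : List 𝔠
    Xs = (λ _ → false) ∷ map proj₁ is

    word : ℕ → 𝔠 → List (Bool × Bool)
    word n X = applyUpTo (λ k → X k ,′ α X k) n

    unique : ∀ {n} →
      (∀ {X Z} → X ∈ˡ Xs → Z ∈ˡ Xs → (∀ k → k < n → X k ≡ Z k) → X ≡ Z) →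
      ∀ {X} → X ∈ˡ Xs → ∀ f → applyUpTo f n ∈ˡ map (word n) Xs →
      (∀ k → k < n → proj₁ (f k) ≡ X k) →
      ∀ k → k < n → proj₂ (f k) ≡ α X k
    unique {n} separated {X} X∈ f f∈ f₁≡X k k<n =
      let
        X′ , X′∈ , eq = ∈-map⁻ (word n) f∈
        f≡ = applyUpTo-injective f (λ k → X′ k ,′ α X′ k) n eq
        X′≡X = separated X′∈ X∈ (λ j j<n →
          trans (sym (cong proj₁ (f≡ j j<n))) (f₁≡X j j<n))
      in trans (cong proj₂ (f≡ k k<n)) (cong (λ X → α X k) X′≡X)

  -- Regularity of compact Hausdorff spaces.

  regular : ∀ (X : Space) → Compact X → Hausdorff X →
    ∀ {x W} → Open X W → x ∈ W → Shrinking X x W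
  regular X compact hausdorff {x} {W} oW x∈W = record
    { V        = λ t → All (λ z → t ∈ V z) zs
    ; V-open   = Open-All X V V-open zs
    ; x∈V      = All.tabulate (λ {z} _ → x∈V z)
    ; separate = separate
    }
    where
    record Nbhds (z : Carrier X) : Set₁ where
      field
        V O       : Subset (Carrier X)
        V-open    : Open X V
        O-open    : Open X O
        x∈V       : x ∈ V
        z∈O       : z ∈ O
        O⊆W⊎V⊥O   : O ⊆ W ⊎ V ⊥ O

    nbhds : ∀ z → Nbhds z
    -- Points of `W` are covered by `W` itself, the others by neighbourhoods disjoint from one of
    -- `x`; `V` is the intersection over a finite subcover.
    nbhds z with em {P = z ∈ W}
    ... | yes z∈W = record
      { V-open = Open-U X ; O-open = oW ; x∈V = tt ; z∈O = z∈W ; O⊆W⊎V⊥O = inj₁ id }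
    ... | no  z∉W with _ , _ , oV , oO , x∈V , z∈O , V⊥O ←
                       hausdorff {x} {z} (λ { refl → z∉W x∈W }) = record
      { V-open = oV ; O-open = oO ; x∈V = x∈V ; z∈O = z∈O ; O⊆W⊎V⊥O = inj₂ V⊥O }

    open module N z = Nbhds (nbhds z)

    finite : Σ[ zs ∈ List (Carrier X) ] (∀ t → Any (λ z → t ∈ O z) zs)
    finite = compact O O-open (λ z → z , z∈O z)

    zs : List (Carrier X)
    zs = proj₁ finite

    separate : ∀ {z} → z ∉ W → Σ[ O′ ∈ Subset (Carrier X) ]
      Open X O′ × z ∈ O′ × (O′ ⊥ λ t → All (λ y → t ∈ V y) zs)
    separate {z} z∉W with y , y∈ , z∈Oy ← find (proj₂ finite z) with O⊆W⊎V⊥O y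
    ... | inj₁ O⊆W = contradiction (O⊆W z∈Oy) z∉W
    ... | inj₂ V⊥O = O y , O-open y , z∈Oy , λ (p , ps) → V⊥O (All.lookup ps y∈ , p)

  module _ {βω : Space} {ι : ℕ → Carrier βω} (sč : IsStoneČech ω βω ι) where

    open IsStoneČech sč

    -- Clopen closures in βω of subsets of ω.

    dense-ι : ∀ {V} → Open βω V → ∀ {x} → x ∈ V → ∃[ n ] ι n ∈ V
    dense-ι {V} oV x∈V with _ , y∈V , n , refl ← dense V oV (-, x∈V) = n , y∈V

    extension : ∀ A → Σ[ g ∈ (Carrier βω → Bool) ]
      Continuous βω (discrete Bool) g × g ∘ ι ≗ indicator A
    extension A = extend (discrete Bool) discrete-Bool-compact discrete-hausdorff
      (indicator A) (λ _ _ → _)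

    -- This is the closure of the image of A under ι.
    closure : Subset ℕ → Subset (Carrier βω)
    closure A x = proj₁ (extension A) x ≡ true

    closure-open : ∀ A → Open βω (closure A)
    closure-open A = proj₁ (proj₂ (extension A)) (_≡ true) _

    closure-ι⁺ : ∀ A {n} → n ∈ A → ι n ∈ closure A
    closure-ι⁺ A {n} n∈A = trans (proj₂ (proj₂ (extension A)) n) (indicator⁺ A n∈A)

    closure-ι⁻ : ∀ A {n} → ι n ∈ closure A → n ∈ A
    closure-ι⁻ A {n} p = indicator⁻ A (trans (sym (proj₂ (proj₂ (extension A)) n)) p)

    -- The intersection of the closures is open, so by density it would contain some `ι n`.
    closure-disjoint : ∀ {A B} → A ⊥ B → closure A ⊥ closure B
    closure-disjoint {A} {B} A⊥B p
      with n , n∈A , n∈B ← dense-ι (Open-∩ βω (closure-open A) (closure-open B)) p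
      = A⊥B (closure-ι⁻ A n∈A , closure-ι⁻ B n∈B)

    -- Otherwise the open complements of the closures cover βω. A finite subcover then misses `ι m`
    -- for any `m` common to the corresponding sets `A i`.
    closures-meet : ∀ {I : Set} (A : I → Subset ℕ) →
      (∀ is → ∃[ m ] (∀ {i} → i ∈ˡ is → m ∈ A i)) →
      ∃[ p ] (∀ i → p ∈ closure (A i))
    closures-meet {I} A fip = by-contradiction λ none →
      let
        cover : ∀ x → ∃[ i ] proj₁ (extension (A i)) x ≡ false
        cover x = by-contradiction λ x∉ → none (x , λ i → ≢false (λ eq → x∉ (i , eq)))
        is , finite = compact (λ i x → proj₁ (extension (A i)) x ≡ false)
          (λ i → proj₁ (proj₂ (extension (A i))) (_≡ false) _) cover
        m , m∈ = fip is
        i , i∈ , eq = find (finite (ι m))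
      in true≢false (trans (sym (closure-ι⁺ (A i) (m∈ i∈))) eq)
      where
      ≢false : ∀ {b} → b ≢ false → b ≡ true
      ≢false {false} b≢ = contradiction refl b≢
      ≢false {true}  b≢ = refl
      true≢false : true ≢ false
      true≢false ()

    -- Copies of `Y` chosen along a row of the matrix.

    ω* : Space
    ω* = Remainder ω βω ι

    -- A point `ι m` fails the bound `suc (size m)`.
    matrix-free : ∀ {X Z p} → (∀ N → p ∈ closure (matrix X Z N)) → p ∉ Image ι
    matrix-free p∈ (m , refl) =
      1+n≰n (proj₁ (closure-ι⁻ (matrix _ _ _) (p∈ (suc (size m)))))

    matrix-injective : ∀ {X Z Z′ p} → p ∈ closure (matrix X Z 0) →
      (∀ N → p ∈ closure (matrix X Z′ N)) → Z ≡ Z′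
    matrix-injective {X} p∈ p∈′ = by-contradiction λ Z≢Z′ →
      let k , Zk≢ = ≢⇒differ Z≢Z′
      in closure-disjoint (matrix-disjoint X Zk≢) (p∈ , p∈′ (suc k))

    -- Ranging over all `N` expresses membership in the closure of an entry along the filter of the
    -- sets of large size.
    Transversal : Subset (Carrier ω*) → 𝔠 → {B : Set} → (B → 𝔠) → Set
    Transversal P i {B} e = ∀ y → Σ[ p ∈ Carrier ω* ]
      p ∈ P × (∀ N → value p ∈ closure (matrix i (e y) N))

    transversal-exists : ∀ {B : Set} (e : B → 𝔠) (P : 𝔠 → Subset (Carrier ω*)) →
      (∀ x → x ∈ ⋃ 𝔠 P) → ∃[ i ] Transversal (P i) i e
    transversal-exists e P cover = by-contradiction λ none →
      let
        missed : ∀ i → ∃[ y ] ¬ (Σ[ p ∈ Carrier ω* ]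
          p ∈ P i × (∀ N → value p ∈ closure (matrix i (e y) N)))
        missed i = by-contradiction λ hit →
          none (i , λ y → by-contradiction λ y-missed → hit (y , y-missed))
        α = λ i → e (proj₁ (missed i))
        p , p∈ = closures-meet (λ (X , N) → matrix X (α X) N) (matrix-independent α)
        -- Any single row, taken with all bounds `N`, shows that `p` lies outside the image of `ι`;
        -- the zero sequence serves.
        p* = p , [ matrix-free (λ N → p∈ ((λ _ → false) , N)) ]
        i , p∈P = cover p*
      in proj₂ (missed i) (p* , p∈P , λ N → p∈ (i , N))

    -- The closures of the row entries at bound 0 are open and each contains exactly one chosen
    -- point, so the chosen points form a discrete subspace.
    transversal-≅ : ∀ {P i} (Y : Space) → Discrete Y →
      (e : Carrier Y → 𝔠) → (∀ {y y′} → e y ≡ e y′ → y ≡ y′) →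
      Transversal P i e →
      Σ[ Y′ ∈ Subset (Carrier ω*) ] Y′ ⊆ P × Subspace ω* Y′ ≅ Y
    transversal-≅ {P} {i} Y disc e e-injective t =
      Image x , (λ { (y , refl) → proj₁ (proj₂ (t y)) }) , record
        { bijection       = mk↔ₛ′ to from to-from from-to
        ; to-continuous   = to-continuous
        ; from-continuous = λ V _ → disc (V ∘ from)
        }
      where
      x : Carrier Y → Carrier ω*
      x y = proj₁ (t y)

      x∈ : ∀ y N → value (x y) ∈ closure (matrix i (e y) N)
      x∈ y = proj₂ (proj₂ (t y))

      preimage : (q : Carrier (Subspace ω* (Image x))) → ∃[ y ] x y ≡ value q
      -- Excluded middle recovers a usable witness from the irrelevant membership proof.
      preimage (_ , [ p∈ ]) = recompute em p∈

      to : Carrier (Subspace ω* (Image x)) → Carrier Y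
      to = proj₁ ∘ preimage

      from : Carrier Y → Carrier (Subspace ω* (Image x))
      from y = x y , [ (y , refl) ]

      x-column : ∀ {y y′} → value (x y′) ∈ closure (matrix i (e y) 0) → y ≡ y′
      x-column {y} {y′} p = e-injective (matrix-injective p (x∈ y′))

      value-injective : ∀ {q r : Carrier (Subspace ω* (Image x))} → value q ≡ value r → q ≡ r
      value-injective refl = refl

      to-column : ∀ q → value (value q) ∈ closure (matrix i (e (to q)) 0)
      to-column q = subst (λ p → value p ∈ closure (matrix i (e (to q)) 0))
        (proj₂ (preimage q)) (x∈ (to q) 0)

      to-unique : ∀ {y} q → value (value q) ∈ closure (matrix i (e y) 0) → y ≡ to q
      to-unique {y} q p = x-column (subst (λ p → value p ∈ closure (matrix i (e y) 0))
        (sym (proj₂ (preimage q))) p)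

      to-from : ∀ y → to (from y) ≡ y
      to-from y = sym (to-unique (from y) (x∈ y 0))

      from-to : ∀ q → from (to q) ≡ q
      from-to q = value-injective (proj₂ (preimage q))

      to-continuous : Continuous (Subspace ω* (Image x)) Y to
      to-continuous V _ =
          W ∘ value
        , (W , Open-⋃ βω column (λ (y , _) → closure-open (matrix i (e y) 0)) , id , id)
        , (λ {q} to-q∈V → (to q , to-q∈V) , to-column q)
        , λ {q} ((y , y∈V) , p) → subst V (to-unique q p) y∈V
        where
        column : ∃ V → Subset (Carrier βω)
        column (y , _) = closure (matrix i (e y) 0)

        W : Subset (Carrier βω)
        W = ⋃ (∃ V) column

    -- The cardinality bound for discrete subspaces of ω*.

    discrete-subspace-≤𝔠 : ∀ (Y : Space) → Discrete Y → (S : Subset (Carrier ω*)) →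
      Y ≅ Subspace ω* S → Carrier Y ≤ᶜ 𝔠
    discrete-subspace-≤𝔠 Y disc S h = mk↣ trace-injective
      where
      open Inverse (_≅_.bijection h) using (to; from; strictlyInverseʳ)

      point : Carrier Y → Carrier βω
      point = value ∘ value ∘ to

      record Isolating (y : Carrier Y) : Set₁ where
        field
          W        : Subset (Carrier βω)
          W-open   : Open βω W
          y∈W      : point y ∈ W
          isolates : ∀ {y′} → point y′ ∈ W → y′ ≡ y

      isolating : ∀ y → Isolating y
      isolating y with W* , (W , W-open , W*⊆W , W⊆W*) , ⊆W* , W*⊆ ←
                       _≅_.from-continuous h (_≡ y) (disc _) = record
        { W        = W
        ; W-open   = W-open
        ; y∈W      = W*⊆W (⊆W* (strictlyInverseʳ y))
        ; isolates = λ {y′} p → trans (sym (strictlyInverseʳ y′)) (W*⊆ (W⊆W* p))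
        }

      open module I y = Isolating (isolating y)

      shrinking : ∀ y → Shrinking βω (point y) (W y)
      shrinking y = regular βω compact hausdorff (W-open y) (y∈W y)

      open module S y = Shrinking (shrinking y)

      trace : Carrier Y → 𝔠
      trace y = indicator (V y ∘ ι)

      trace-injective : ∀ {y y′} → trace y ≡ trace y′ → y ≡ y′
      -- As `W y′` isolates `point y′`, it omits `point y`, which thus has a neighbourhood `O`
      -- disjoint from `V y′`. Density gives some `n` with `ι n` in both `O` and `V y`, so `n` is in
      -- the trace of `y` only.
      trace-injective {y} {y′} eq = by-contradiction λ y≢y′ →
        let
          O , O-open , y∈O , O⊥V = separate y′ (λ p → y≢y′ (isolates y′ p))
          n , n∈O , n∈V = dense-ι (Open-∩ βω O-open (V-open y)) (y∈O , x∈V y)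
        in O⊥V (n∈O , indicator⁻ (V y′ ∘ ι)
             (trans (sym (cong (λ t → t n) eq)) (indicator⁺ (V y ∘ ι) n∈V)))

-- The cycle of implications between the four conditions.

theorem3p1 : (∀ {ℓ} → ExcludedMiddle ℓ) → (∀ {a b} → Extensionality a b) →
    ∀ (βω : Space) (ι : Carrier ω → Carrier βω) → IsStoneČech ω βω ι →
    let ω* = Remainder ω βω ι in
    ∀ (Y : Space) → Discrete Y →
    ((Carrier Y ≤ᶜ 𝔠) ⇔ (ω* ⟶⟨ 𝔠 ⟩¹ Y)) ×
    ((ω* ⟶⟨ 𝔠 ⟩¹ Y) ⇔ (ω* ⟶⟨ Fin 2 ⟩¹ Y)) ×
    ((ω* ⟶⟨ Fin 2 ⟩¹ Y) ⇔ (Σ[ S ∈ Subset (Carrier ω*) ] Y ≅ Subspace ω* S))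
theorem3p1 em fe βω ι sč Y disc =
  mk⇔ a⇒b (d⇒a ∘ c⇒d ∘ b⇒c) , mk⇔ b⇒c (a⇒b ∘ d⇒a ∘ c⇒d) , mk⇔ c⇒d (b⇒c ∘ a⇒b ∘ d⇒a)
  where
  R : Space
  R = Remainder ω βω ι

  a⇒b : Carrier Y ≤ᶜ 𝔠 → R ⟶⟨ 𝔠 ⟩¹ Y
  a⇒b e P cover =
    let i , t = transversal-exists em fe sč (Injection.to e) P cover
    in i , transversal-≅ em fe sč Y disc (Injection.to e) (Injection.injective e) t

  b⇒c : R ⟶⟨ 𝔠 ⟩¹ Y → R ⟶⟨ Fin 2 ⟩¹ Y
  b⇒c b P cover = colour (proj₁ piece) , proj₂ piece
    where
    -- The first bit maps 𝔠 onto two colours, so repeating the two pieces along it still gives a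
    -- cover.
    colour : 𝔠 → Fin 2
    colour X = if X 0 then suc zero else zero

    preimage : ∀ {x} → x ∈ ⋃ (Fin 2) P → x ∈ ⋃ 𝔠 (P ∘ colour)
    preimage (zero , p)     = (λ _ → false) , p
    preimage (suc zero , p) = (λ _ → true) , p

    piece = b (P ∘ colour) (λ x → preimage (cover x))

  c⇒d : R ⟶⟨ Fin 2 ⟩¹ Y → Σ[ S ∈ Subset (Carrier R) ] Y ≅ Subspace R S
  c⇒d c =
    -- Both pieces are the whole space.
    let _ , S , _ , h = c (λ _ → U) (λ _ → zero , tt)
    in S , ≅-sym h

  d⇒a : Σ[ S ∈ Subset (Carrier R) ] Y ≅ Subspace R S → Carrier Y ≤ᶜ 𝔠
  d⇒a (S , h) = discrete-subspace-≤𝔠 em fe sč Y disc S h
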